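{- Let $n \geq 5$. Then the circulant graph $C(n,\{1,2\})$ is nearly dispersable.
   Context: All graphs are finite and simple. For a set $S=\{i_1<\cdots<i_k\}$ of integers with $k\ge 1$, $1\le i_1$ and $i_k\le \lfloor n/2\rfloor$, the circulant $C(n,S)$ is the graph on vertex set $\{1,\ldots,n\}$ in which each $j$ is adjacent to $j+i_r$ (addition mod $n$) for $r=1,\ldots,k$. Given a graph $G$ and a cyclic order $\omega$ on $V(G)$, draw the vertices on a circle in the order $\omega$ and the edges as straight chords; two edges cross if they intersect at a point that is not an endpoint. A matching book embedding $(G,\omega,c)$ consists of $G$, a cyclic order $\omega$, and an edge-coloring $c$ (the color classes are the pages) such that any two distinct edges of the same color neither cross nor share an endpoint. The embedding is dispersable if the number of colors equals the maximum degree $\Delta(G)$, and nearly dispersable if the number of colors equals $1+\Delta(G)$. A graph is dispersable if it has a dispersable matching book embedding; it is nearly dispersable if it is not dispersable and has a nearly dispersable matching book embedding. -}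

module Defs where

open import Data.Fin.Base using (Fin; toℕ; _<_)
open import Data.Fin.Permutation using (Permutation′; _⟨$⟩ʳ_)
open import Data.Fin.Properties using (nonZeroIndex; toℕ<n; toℕ-fromℕ<; _≟_)
open import Data.List.Base using (List; []; _∷_; allFin; filter; length; map)
open import Data.List.Extrema.Nat using (max)
open import Data.List.Membership.Propositional using (find)
open import Data.List.Relation.Unary.All as All using (All; []; _∷_)
open import Data.List.Relation.Unary.Any as Any using (Any; any?)
open import Data.List.Relation.Unary.Linked using (Linked; [-]; _∷_)
open import Data.Nat.Base as ℕ using (ℕ; suc; _+_; _∸_; _≤_; ⌊_/2⌋; s≤s; z≤n)
open import Data.Nat.DivMod using (_%_; _mod_; m<n⇒m%n≡m; m≤n⇒[n∸m]%m≡n%m)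
import Data.Nat.Properties as ℕ
open import Data.Product.Base using (_×_; _,_)
open import Data.Sum.Base as Sum using (_⊎_; inj₁; inj₂)
open import Function.Definitions using (Surjective)
open import Relation.Binary.Definitions using (Decidable; Irreflexive; Symmetric)
open import Relation.Binary.PropositionalEquality
open import Relation.Nullary using (¬_; yes; no)
open import Relation.Nullary.Decidable using (_⊎-dec_)

record Graph (n : ℕ) : Set₁ where
  field
    Adj     : Fin n → Fin n → Set
    adj?    : Decidable Adj
    symm    : Symmetric Adj
    irrefl  : Irreflexive _≡_ Adj

  degree : Fin n → ℕ
  degree v = length (filter (adj? v) (allFin n))

  maxDegree : ℕ
  maxDegree = max 0 (map degree (allFin n))

open Graph public using (degree; maxDegree)

-- An unordered edge is represented by its endpoints in increasing order.  The
-- proofs are irrelevant, so edges are equal exactly when their endpoints are.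
record Edge {n : ℕ} (G : Graph n) : Set where
  constructor edge
  field
    src tgt  : Fin n
    .src<tgt : src < tgt
    .adj     : Graph.Adj G src tgt

open Edge public using (src; tgt)

ShareEndpoint : ∀ {n} {G : Graph n} → Edge G → Edge G → Set
ShareEndpoint e f =
  (src e ≡ src f ⊎ src e ≡ tgt f) ⊎ (tgt e ≡ src f ⊎ tgt e ≡ tgt f)

-- Positions on the circle are numbered clockwise; x, y, z are distinct and
-- are met in this order when going clockwise from x.
Clockwise : ∀ {n} → Fin n → Fin n → Fin n → Set
Clockwise x y z = (x < y × y < z) ⊎ (y < z × z < x) ⊎ (z < x × x < y)

-- A cyclic order on the vertices is given by the position of each vertex on the
-- circle.  Rotating all positions leaves Clockwise, hence Crosses, unchanged.
CyclicOrder : ℕ → Set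
CyclicOrder = Permutation′

-- Two chords of a circle meet at a point that is not an endpoint iff the
-- endpoints of one lie strictly on different sides of the other.
Crosses : ∀ {n} {G : Graph n} → CyclicOrder n → Edge G → Edge G → Set
Crosses ω e f =
  (Clockwise a c b × Clockwise b d a) ⊎ (Clockwise a d b × Clockwise b c a)
  where
  a = ω ⟨$⟩ʳ src e
  b = ω ⟨$⟩ʳ tgt e
  c = ω ⟨$⟩ʳ src f
  d = ω ⟨$⟩ʳ tgt f

-- Surjectivity of the colouring makes k the actual number of colours.
record MatchingBookEmbedding {n : ℕ} (G : Graph n) (k : ℕ) : Set where
  field
    order        : CyclicOrder n
    colour       : Edge G → Fin k
    surjective   : Surjective _≡_ _≡_ colour
    matching     : ∀ e f → e ≢ f → colour e ≡ colour f → ¬ ShareEndpoint e f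
    non-crossing : ∀ e f → e ≢ f → colour e ≡ colour f → ¬ Crosses order e f

Dispersable : ∀ {n} → Graph n → Set
Dispersable G = MatchingBookEmbedding G (maxDegree G)

NearlyDispersable : ∀ {n} → Graph n → Set
NearlyDispersable G =
  ¬ Dispersable G × MatchingBookEmbedding G (1 + maxDegree G)

record IsConnectionSet (n : ℕ) (S : List ℕ) : Set where
  field
    nonEmpty   : S ≢ []
    increasing : Linked ℕ._<_ S
    bounded    : All (λ i → 1 ≤ i × i ≤ ⌊ n /2⌋) S

_⊕_ : ∀ {n} → Fin n → ℕ → Fin n
_⊕_ {n} j i = (toℕ j + i) mod n
  where instance _ = nonZeroIndex j

⊕-no-fixpoint : ∀ {n} (j : Fin n) {i} → 1 ≤ i → i ≤ ⌊ n /2⌋ → j ≢ j ⊕ i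
⊕-no-fixpoint {n@(suc m)} j {i} 1≤i i≤n/2 j≡j⊕i with toℕ j + i ℕ.<? n
... | yes j+i<n = ℕ.<⇒≢ (ℕ.m<m+n (toℕ j) 1≤i) (begin
  toℕ j             ≡⟨ cong toℕ j≡j⊕i ⟩
  toℕ (j ⊕ i)       ≡⟨ toℕ-fromℕ< _ ⟩
  (toℕ j + i) % n   ≡⟨ m<n⇒m%n≡m j+i<n ⟩
  toℕ j + i         ∎)
  where open ≡-Reasoning
... | no  j+i≮n = ℕ.<⇒≢ r<j (sym (begin
  toℕ j                 ≡⟨ cong toℕ j≡j⊕i ⟩
  toℕ (j ⊕ i)           ≡⟨ toℕ-fromℕ< _ ⟩
  (toℕ j + i) % n       ≡⟨ m≤n⇒[n∸m]%m≡n%m n≤j+i ⟨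
  (toℕ j + i ∸ n) % n   ≡⟨ m<n⇒m%n≡m (ℕ.<-trans r<j (toℕ<n j)) ⟩
  toℕ j + i ∸ n         ∎))
  where
  open ≡-Reasoning
  n≤j+i : n ≤ toℕ j + i
  n≤j+i = ℕ.≮⇒≥ j+i≮n
  i<n : i ℕ.< n
  i<n = ℕ.≤-<-trans i≤n/2 (ℕ.⌊n/2⌋<n m)
  r<j : toℕ j + i ∸ n ℕ.< toℕ j
  r<j = subst (toℕ j + i ∸ n ℕ.<_) (ℕ.m+n∸n≡m (toℕ j) n)
          (ℕ.∸-monoˡ-< (ℕ.+-monoʳ-< (toℕ j) i<n) n≤j+i)

-- The circulant C(n,S), with the vertices 1,…,n taken as residues 0,…,n-1.
circulant : (n : ℕ) (S : List ℕ) → IsConnectionSet n S → Graph n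
circulant n S isS = record
  { Adj    = λ u v → Any (λ i → v ≡ u ⊕ i ⊎ u ≡ v ⊕ i) S
  ; adj?   = λ u v → any? (λ i → (v ≟ u ⊕ i) ⊎-dec (u ≟ v ⊕ i)) S
  ; symm   = Any.map Sum.swap
  ; irrefl = irr
  }
  where
  irr : ∀ {u v} → u ≡ v → ¬ Any (λ i → v ≡ u ⊕ i ⊎ u ≡ v ⊕ i) S
  irr {u} refl p with i , i∈S , q ← find p
    with 1≤i , i≤n/2 ← All.lookup (IsConnectionSet.bounded isS) i∈S =
    ⊕-no-fixpoint u 1≤i i≤n/2 (Sum.reduce q)

isConnectionSet-1,2 : ∀ {n} → 5 ≤ n → IsConnectionSet n (1 ∷ 2 ∷ [])
isConnectionSet-1,2 5≤n = record
  { nonEmpty   = λ ()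
  ; increasing = s≤s (s≤s z≤n) ∷ [-]
  ; bounded    = (s≤s z≤n , ℕ.≤-trans (s≤s z≤n) 2≤n/2) ∷ (s≤s z≤n , 2≤n/2) ∷ []
  }
  where
  2≤n/2 = ℕ.⌊n/2⌋-mono 5≤n

{-# OPTIONS --safe #-}

-- Lower bound: in a k-regular graph with k pages every page is a perfect matching.  A chord
-- of a non-crossing perfect matching has an even number of positions between its ends, so
-- adjacent vertices have positions of opposite parity; this is impossible on a triangle.
--
-- Upper bound: place the even vertices in increasing order, then the odd ones in decreasing
-- order.  The edges {i,i+1} with i of fixed parity are nested, which gives two pages.  The
-- edges {i,i+2} join neighbouring positions, so they cross nothing; they share three pages
-- with the edges {0,n-1}, {0,n-2} and {1,n-1}, and only endpoints matter there.
module Submission where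

open import Defs
open import Data.Empty using (⊥-elim-irr)
open import Data.Fin.Base as Fin using (Fin; zero; suc; toℕ; fromℕ<)
open import Data.Fin.Permutation using (permutation; _⟨$⟩ʳ_; _⟨$⟩ˡ_; inverseˡ; inverseʳ)
import Data.Fin.Properties as Fin
open import Data.List.Base using (List; []; _∷_; allFin; filter; lookup; map)
open import Data.List.Extrema.Nat using (max≤v⁺; v≤max⁺)
open import Data.List.Membership.Propositional using (_∈_; lose)
open import Data.List.Membership.Propositional.Properties
  using (∈-filter⁺; ∈-filter⁻; ∈-lookup; ∈-allFin)
import Data.List.Relation.Unary.All as All
import Data.List.Relation.Unary.All.Properties as All
open import Data.List.Relation.Unary.AllPairs using (_∷_)
open import Data.List.Relation.Unary.Any as Any using (Any; here; there)
import Data.List.Relation.Unary.Any.Properties as Any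
open import Data.List.Relation.Unary.Unique.Propositional using (Unique)
import Data.List.Relation.Unary.Unique.Propositional.Properties as Unique
open import Data.Nat.Base as ℕ
  using (ℕ; suc; _+_; _∸_; _≤_; _<_; z≤n; s≤s; parity; pred; ⌊_/2⌋; ⌈_/2⌉)
open import Data.Nat.DivMod using (_%_; m<n⇒m%n≡m; m≤n⇒[n∸m]%m≡n%m)
import Data.Nat.Properties as ℕ
open import Data.Parity.Base using (Parity; 0ℙ; 1ℙ; _⁻¹)
open import Data.Parity.Properties using (suc-homo-⁻¹; ⁻¹-injective; ⁻¹-involutive; p≢p⁻¹)
open import Data.Product.Base using (∃; _×_; _,_; proj₁; proj₂)
open import Data.Sum.Base as Sum using (_⊎_; inj₁; inj₂)
open import Function.Base using (_∘_)
open import Function.Definitions using (Injective)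
open import Relation.Binary.Definitions using (tri<; tri≈; tri>)
open import Relation.Binary.PropositionalEquality
open import Relation.Nullary using (¬_; yes; no; contradiction; recompute)

-- Counting by injections between finite sets.

-- If `y` were missed, punching it out of the codomain would inject `Fin (suc n)` into `Fin n`.
injective⇒surjective : ∀ {n} {f : Fin n → Fin n} → Injective _≡_ _≡_ f → ∀ y → ∃ λ x → f x ≡ y
injective⇒surjective {suc n} {f} f-inj y with Fin.any? (λ x → f x Fin.≟ y)
... | yes hit  = hit
... | no  miss =
  contradiction (Fin.injective⇒≤ (f-inj ∘ Fin.punchOut-injective (≢f _) (≢f _))) ℕ.1+n≰n
  where
  ≢f : ∀ x → y ≢ f x
  ≢f x y≡fx = miss (x , sym y≡fx)

lookup-injective : ∀ {A : Set} {xs : List A} → Unique xs → Injective _≡_ _≡_ (lookup xs)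
lookup-injective (x∉ ∷ u) {zero}  {zero}  _  = refl
lookup-injective (x∉ ∷ u) {zero}  {suc j} eq = contradiction eq (All.lookup x∉ (∈-lookup j))
lookup-injective (x∉ ∷ u) {suc i} {zero}  eq = contradiction (sym eq) (All.lookup x∉ (∈-lookup i))
lookup-injective (x∉ ∷ u) {suc i} {suc j} eq = cong suc (lookup-injective u eq)

-- Injections both ways between `Fin k` and the indices of the filtered list give the two
-- inequalities, whatever the order in which `filter` lists the neighbours.
degree-≡ : ∀ {k n} (G : Graph n) (v : Fin n) (nbr : Fin k → Fin n) → Injective _≡_ _≡_ nbr →
           (∀ i → Graph.Adj G v (nbr i)) → (∀ {w} → Graph.Adj G v w → ∃ λ i → nbr i ≡ w) →
           degree G v ≡ k
degree-≡ {k} {n} G v nbr nbr-inj nbr-adj nbr-all = ℕ.≤-antisym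
  (Fin.injective⇒≤ {f = λ j → proj₁ (listed j)} λ {i} {j} eq →
    lookup-injective (Unique.filter⁺ (Graph.adj? G v) (Unique.allFin⁺ n))
      (trans (sym (proj₂ (listed i))) (trans (cong nbr eq) (proj₂ (listed j)))))
  (Fin.injective⇒≤ {f = λ i → Any.index (present i)} λ {i} {j} eq →
    nbr-inj (trans (Any.lookup-index (present i))
      (trans (cong (lookup nbrs) eq) (sym (Any.lookup-index (present j))))))
  where
  nbrs = filter (Graph.adj? G v) (allFin n)
  listed : ∀ j → ∃ λ i → nbr i ≡ lookup nbrs j
  listed j = nbr-all (proj₂ (∈-filter⁻ (Graph.adj? G v) {xs = allFin n} (∈-lookup j)))
  present : ∀ i → nbr i ∈ nbrs
  present i = ∈-filter⁺ (Graph.adj? G v) (∈-allFin (nbr i)) (nbr-adj i)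

-- Chords between numbered positions on the circle.

-- The types to which Defs.Clockwise and Defs.Crosses unfold when positions are numbers.
Clockwiseℕ : (x y z : ℕ) → Set
Clockwiseℕ x y z = (x < y × y < z) ⊎ (y < z × z < x) ⊎ (z < x × x < y)

Cross : (a b c d : ℕ) → Set
Cross a b c d = (Clockwiseℕ a c b × Clockwiseℕ b d a) ⊎ (Clockwiseℕ a d b × Clockwiseℕ b c a)

clockwise-rotate : ∀ {x y z} → Clockwiseℕ x y z → Clockwiseℕ y z x
clockwise-rotate (inj₁ p)        = inj₂ (inj₂ p)
clockwise-rotate (inj₂ (inj₁ p)) = inj₁ p
clockwise-rotate (inj₂ (inj₂ p)) = inj₂ (inj₁ p)

-- Seen from `a`, clockwise order is linear: `c` precedes `b` and `b` precedes `d`. The cases differ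
-- in where the numbering starts over.
clockwise-trans : ∀ {a b c d} → Clockwiseℕ a c b → Clockwiseℕ a b d → Clockwiseℕ a c d
clockwise-trans (inj₁ (a<c , c<b)) (inj₁ (a<b , b<d)) = inj₁ (a<c , ℕ.<-trans c<b b<d)
clockwise-trans (inj₁ (a<c , c<b)) (inj₂ (inj₁ (b<d , d<a))) =
  contradiction (ℕ.<-trans b<d d<a) (ℕ.<-asym (ℕ.<-trans a<c c<b))
clockwise-trans (inj₁ (a<c , c<b)) (inj₂ (inj₂ (d<a , a<b))) = inj₂ (inj₂ (d<a , a<c))
clockwise-trans (inj₂ (inj₁ (c<b , b<a))) (inj₁ (a<b , b<d)) = contradiction a<b (ℕ.<-asym b<a)
clockwise-trans (inj₂ (inj₁ (c<b , b<a))) (inj₂ (inj₁ (b<d , d<a))) =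
  inj₂ (inj₁ (ℕ.<-trans c<b b<d , d<a))
clockwise-trans (inj₂ (inj₁ (c<b , b<a))) (inj₂ (inj₂ (d<a , a<b))) =
  contradiction a<b (ℕ.<-asym b<a)
clockwise-trans (inj₂ (inj₂ (b<a , a<c))) (inj₁ (a<b , b<d)) = contradiction a<b (ℕ.<-asym b<a)
clockwise-trans (inj₂ (inj₂ (b<a , a<c))) (inj₂ (inj₁ (b<d , d<a))) = inj₂ (inj₂ (d<a , a<c))
clockwise-trans (inj₂ (inj₂ (b<a , a<c))) (inj₂ (inj₂ (d<a , a<b))) =
  contradiction a<b (ℕ.<-asym b<a)

cross-resp-≡ : ∀ {a a′ b b′ c c′ d d′} → a ≡ a′ → b ≡ b′ → c ≡ c′ → d ≡ d′ →
               Cross a b c d → Cross a′ b′ c′ d′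
cross-resp-≡ refl refl refl refl x = x

cross-swapˡ : ∀ {a b c d} → Cross a b c d → Cross b a c d
cross-swapˡ (inj₁ (p , q)) = inj₂ (q , p)
cross-swapˡ (inj₂ (p , q)) = inj₁ (q , p)

cross-swapʳ : ∀ {a b c d} → Cross a b c d → Cross a b d c
cross-swapʳ = Sum.swap

-- A crossing fixes the cyclic order a, c, b, d or a, d, b, c. Read from `c`, the first is the
-- second alternative for the exchanged chords, and vice versa.
cross-sym : ∀ {a b c d} → Cross a b c d → Cross c d a b
cross-sym = Sum.swap ∘ Sum.map
  (λ (acb , bda) → opposite bda acb , opposite acb bda)
  (λ (adb , bca) → opposite adb bca , opposite bca adb)
  where
  opposite : ∀ {a b c d} → Clockwiseℕ a c b → Clockwiseℕ b d a → Clockwiseℕ d a c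
  opposite acb bda = clockwise-rotate (clockwise-rotate
    (clockwise-trans acb (clockwise-rotate (clockwise-rotate bda))))

between⇒¬clockwise : ∀ {a b x} → a < x → x < b → ¬ Clockwiseℕ b x a
between⇒¬clockwise a<x x<b (inj₁ (b<x , _))        = ℕ.<-asym x<b b<x
between⇒¬clockwise a<x x<b (inj₂ (inj₁ (x<a , _))) = ℕ.<-asym a<x x<a
between⇒¬clockwise a<x x<b (inj₂ (inj₂ (_ , b<x))) = ℕ.<-asym x<b b<x

nested⇒¬cross : ∀ {a b c d} → a < c → c < d → d < b → ¬ Cross a b c d
nested⇒¬cross a<c c<d d<b (inj₁ (_ , bda)) = between⇒¬clockwise (ℕ.<-trans a<c c<d) d<b bda
nested⇒¬cross a<c c<d d<b (inj₂ (_ , bca)) = between⇒¬clockwise a<c (ℕ.<-trans c<d d<b) bca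

consecutive⇒¬clockwise : ∀ {a x} → ¬ Clockwiseℕ a x (suc a)
consecutive⇒¬clockwise (inj₁ (a<x , x<1+a))        = ℕ.<⇒≱ a<x (ℕ.s≤s⁻¹ x<1+a)
consecutive⇒¬clockwise (inj₂ (inj₁ (_ , 1+a<a)))   = ℕ.<-asym 1+a<a (ℕ.n<1+n _)
consecutive⇒¬clockwise (inj₂ (inj₂ (1+a<a , _)))   = ℕ.<-asym 1+a<a (ℕ.n<1+n _)

-- One of the two arcs cut off by the chord contains no position, whereas a crossing chord needs an
-- end on each.
consecutive⇒¬cross : ∀ {a b c d} → b ≡ suc a ⊎ a ≡ suc b → ¬ Cross a b c d
consecutive⇒¬cross (inj₁ refl) (inj₁ (acb , _)) = consecutive⇒¬clockwise acb
consecutive⇒¬cross (inj₁ refl) (inj₂ (adb , _)) = consecutive⇒¬clockwise adb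
consecutive⇒¬cross (inj₂ refl) (inj₁ (_ , bda)) = consecutive⇒¬clockwise bda
consecutive⇒¬cross (inj₂ refl) (inj₂ (_ , bca)) = consecutive⇒¬clockwise bca

-- Edges seen from either end.

-- Edges are stored with increasing ends; this relation forgets that orientation.
Joins : ∀ {n} {G : Graph n} → Edge G → Fin n → Fin n → Set
Joins e u v = (src e ≡ u × tgt e ≡ v) ⊎ (src e ≡ v × tgt e ≡ u)

module _ {n} {G : Graph n} where

  joins-sym : ∀ (e : Edge G) {u v} → Joins e u v → Joins e v u
  joins-sym e = Sum.swap

  joins-irrefl : ∀ (e : Edge G) {u} → ¬ Joins e u u
  joins-irrefl (edge _ _ s<t _) (inj₁ (refl , refl)) = ⊥-elim-irr (ℕ.<-irrefl refl s<t)
  joins-irrefl (edge _ _ s<t _) (inj₂ (refl , refl)) = ⊥-elim-irr (ℕ.<-irrefl refl s<t)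

  joins-unique : ∀ (e : Edge G) {u v w} → Joins e u v → Joins e u w → v ≡ w
  joins-unique e (inj₁ (p , q)) (inj₁ (r , s)) = trans (sym q) s
  joins-unique e (inj₁ (p , q)) (inj₂ (r , s)) = trans (sym q) (trans s (trans (sym p) r))
  joins-unique e (inj₂ (p , q)) (inj₁ (r , s)) = trans (sym p) (trans r (trans (sym q) s))
  joins-unique e (inj₂ (p , q)) (inj₂ (r , s)) = trans (sym p) r

  joins-ends : ∀ (e : Edge G) {u v w x} → Joins e u v → Joins e w x → w ≡ u ⊎ w ≡ v
  joins-ends e (inj₁ (p , q)) (inj₁ (r , s)) = inj₁ (trans (sym r) p)
  joins-ends e (inj₁ (p , q)) (inj₂ (r , s)) = inj₂ (trans (sym s) q)
  joins-ends e (inj₂ (p , q)) (inj₁ (r , s)) = inj₂ (trans (sym r) p)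
  joins-ends e (inj₂ (p , q)) (inj₂ (r , s)) = inj₁ (trans (sym s) q)

  joins⇒share : ∀ (e f : Edge G) {u v w} → Joins e u v → Joins f u w → ShareEndpoint e f
  joins⇒share e f (inj₁ (p , q)) (inj₁ (r , s)) = inj₁ (inj₁ (trans p (sym r)))
  joins⇒share e f (inj₁ (p , q)) (inj₂ (r , s)) = inj₁ (inj₂ (trans p (sym s)))
  joins⇒share e f (inj₂ (p , q)) (inj₁ (r , s)) = inj₂ (inj₁ (trans q (sym r)))
  joins⇒share e f (inj₂ (p , q)) (inj₂ (r , s)) = inj₂ (inj₂ (trans q (sym s)))

  cross⇒crosses : ∀ (ω : CyclicOrder n) (e f : Edge G) {a b c d} → Joins e a b → Joins f c d →
                  Cross (toℕ (ω ⟨$⟩ʳ a)) (toℕ (ω ⟨$⟩ʳ b)) (toℕ (ω ⟨$⟩ʳ c)) (toℕ (ω ⟨$⟩ʳ d)) →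
                  Crosses ω e f
  cross⇒crosses ω e f (inj₁ (refl , refl)) (inj₁ (refl , refl)) x = x
  cross⇒crosses ω e f (inj₁ (refl , refl)) (inj₂ (refl , refl)) x = cross-swapʳ x
  cross⇒crosses ω e f (inj₂ (refl , refl)) (inj₁ (refl , refl)) x = cross-swapˡ x
  cross⇒crosses ω e f (inj₂ (refl , refl)) (inj₂ (refl , refl)) x = cross-swapˡ (cross-swapʳ x)

  adj⇒joined : ∀ {u v} → Graph.Adj G u v → ∃ λ (e : Edge G) → Joins e u v
  adj⇒joined {u} {v} uv with Fin.<-cmp u v
  ... | tri< u<v _ _  = edge u v u<v uv , inj₁ (refl , refl)
  ... | tri≈ _ u≡v _  = contradiction uv (Graph.irrefl G u≡v)
  ... | tri> _ _ v<u  = edge v u v<u (Graph.symm G uv) , inj₂ (refl , refl)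

-- Parity in non-crossing perfect matchings.

parity-suc : ∀ n → parity (suc n) ≡ parity n ⁻¹
parity-suc n = trans (sym (⁻¹-involutive _)) (cong _⁻¹ (suc-homo-⁻¹ n))

-- A page is encoded as a fixed-point-free involution on positions. Of non-crossing only this is
-- kept: an arc that starts inside another ends inside it.
module NonCrossingMatching
  {n}
  (π : Fin n → Fin n)
  (π-involutive : ∀ p → π (π p) ≡ p)
  (π-irrefl : ∀ p → π p ≢ p)
  (π-nested : ∀ {p q} → p Fin.< q → q Fin.< π p → p Fin.< π q × π q Fin.< π p)
  where

  Closed : ℕ → ℕ → Set
  Closed a b = ∀ x → a ≤ toℕ x → toℕ x < b → a ≤ toℕ (π x) × toℕ (π x) < b

  closed-under-arc : ∀ p → Closed (suc (toℕ p)) (toℕ (π p))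
  closed-under-arc p q = π-nested

  -- A closed interval [a,b) splits at the partner p of a into {a,p} and the
  -- closed intervals (a,p) and (p,b).
  closed⇒even : ∀ k {a b} → b ≤ k + a → a ≤ b → b ≤ n → Closed a b → parity a ≡ parity b
  -- `k` bounds the length of the interval and makes the recursion structural.
  closed⇒even k {a} {b} b≤k+a a≤b b≤n cl with ℕ.m≤n⇒m<n∨m≡n a≤b
  closed⇒even k       {a} {b} b≤k+a a≤b b≤n cl | inj₂ refl = refl
  closed⇒even ℕ.zero  {a} {b} b≤k+a a≤b b≤n cl | inj₁ a<b  = contradiction b≤k+a (ℕ.<⇒≱ a<b)
  closed⇒even (suc k) {a} {b} b≤k+a a≤b b≤n cl | inj₁ a<b  = trans (⁻¹-injective (begin
      parity a ⁻¹                ≡⟨ parity-suc a ⟨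
      parity (suc a)             ≡⟨ cong (parity ∘ suc) x≡a ⟨
      parity (suc (toℕ x))       ≡⟨ closed⇒even k
        (ℕ.≤-trans (ℕ.<⇒≤ p<b) (subst (λ y → b ≤ k + suc y) (sym x≡a) b≤k+1+a))
        x<p (ℕ.<⇒≤ (Fin.toℕ<n (π x))) (closed-under-arc x) ⟩
      parity p                   ≡⟨ suc-homo-⁻¹ p ⟨
      parity (suc p) ⁻¹          ∎))
    (closed⇒even k (ℕ.≤-trans b≤k+1+a (ℕ.+-monoʳ-≤ k (s≤s a≤p))) p<b b≤n closed-after)
    where
    open ≡-Reasoning
    x = fromℕ< (ℕ.<-≤-trans a<b b≤n)
    x≡a : toℕ x ≡ a
    x≡a = Fin.toℕ-fromℕ< _
    p = toℕ (π x)
    a≤p = proj₁ (cl x (ℕ.≤-reflexive (sym x≡a)) (subst (_< b) (sym x≡a) a<b))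
    p<b = proj₂ (cl x (ℕ.≤-reflexive (sym x≡a)) (subst (_< b) (sym x≡a) a<b))
    x<p : toℕ x < p
    x<p = ℕ.≤∧≢⇒< (subst (_≤ p) (sym x≡a) a≤p) (π-irrefl x ∘ sym ∘ Fin.toℕ-injective)
    b≤k+1+a : b ≤ k + suc a
    b≤k+1+a = subst (b ≤_) (sym (ℕ.+-suc k a)) b≤k+a
    -- The partner of some `y` beyond `p` is not `p` (then `y` would be `a`), not `a` (then `y`
    -- would be `p`), and not strictly between them (then by `π-nested` so would `y` be).
    closed-after : Closed (suc p) b
    closed-after y p<y y<b with cl y (ℕ.≤-trans a≤p (ℕ.<⇒≤ p<y)) y<b | ℕ.<-cmp (toℕ (π y)) p
    ... | _   , πy<b | tri> _ _ p<πy = p<πy , πy<b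
    ... | _          | tri≈ _ πy≡p _ =
      contradiction (ℕ.≤-<-trans a≤p (subst (p <_) y≡a p<y)) (ℕ.<-irrefl refl)
      where
      y≡a : toℕ y ≡ a
      y≡a = trans (cong toℕ (trans (sym (π-involutive y))
              (trans (cong π (Fin.toℕ-injective πy≡p)) (π-involutive x)))) x≡a
    ... | a≤πy , _   | tri< πy<p _ _ with ℕ.m≤n⇒m<n∨m≡n a≤πy
    ...   | inj₂ a≡πy = contradiction p<y (ℕ.<-irrefl (cong toℕ
              (trans (cong π (Fin.toℕ-injective (trans x≡a a≡πy))) (π-involutive y))))
    ...   | inj₁ a<πy = contradiction
              (subst (λ z → toℕ z < p) (π-involutive y)
                (proj₂ (π-nested (subst (_< toℕ (π y)) (sym x≡a) a<πy) πy<p)))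
              (ℕ.<-asym p<y)

  private
    arc-even : ∀ p → p Fin.< π p → parity (suc (toℕ p)) ≡ parity (toℕ (π p))
    arc-even p p<πp = closed⇒even (toℕ (π p)) (ℕ.m≤m+n _ _) p<πp
      (ℕ.<⇒≤ (Fin.toℕ<n (π p))) (closed-under-arc p)

  -- The interval strictly inside an arc is closed, hence of even length, so the two ends are an odd
  -- distance apart. If `π p` comes first, the arc is read from that end.
  arc-parity : ∀ p → parity (toℕ (π p)) ≡ parity (toℕ p) ⁻¹
  arc-parity p with Fin.<-cmp p (π p)
  ... | tri< p<πp _ _ = trans (sym (arc-even p p<πp)) (parity-suc (toℕ p))
  ... | tri≈ _ p≡πp _ = contradiction (sym p≡πp) (π-irrefl p)
  ... | tri> _ _ πp<p = begin
    parity (toℕ (π p))             ≡⟨ suc-homo-⁻¹ (toℕ (π p)) ⟨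
    parity (suc (toℕ (π p))) ⁻¹    ≡⟨ cong _⁻¹ (arc-even (π p)
      (subst (π p Fin.<_) (sym (π-involutive p)) πp<p)) ⟩
    parity (toℕ (π (π p))) ⁻¹      ≡⟨ cong (λ q → parity (toℕ q) ⁻¹) (π-involutive p) ⟩
    parity (toℕ p) ⁻¹              ∎
    where open ≡-Reasoning

-- Pages of a regular graph as perfect matchings.

-- With as many pages as the degree, every page meets every vertex.
module RegularEmbedding
  {k n}
  {G : Graph n}
  (nbr : Fin n → Fin k → Fin n)
  (nbr-inj : ∀ u → Injective _≡_ _≡_ (nbr u))
  (nbr-adj : ∀ u i → Graph.Adj G u (nbr u i))
  (E : MatchingBookEmbedding G k)
  where
  open MatchingBookEmbedding E

  private
    ray : ∀ u i → ∃ λ (e : Edge G) → Joins e u (nbr u i)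
    ray u i = adj⇒joined {G = G} (nbr-adj u i)

  -- Otherwise `e` and `f` would be distinct edges of one page sharing `u`.
  same-page⇒≡ : ∀ e f {u v w} → colour e ≡ colour f → Joins e u v → Joins f u w → v ≡ w
  same-page⇒≡ e f {v = v} {w} ce≡cf je jf with v Fin.≟ w
  ... | yes v≡w = v≡w
  ... | no  v≢w = contradiction (joins⇒share e f je jf)
    (matching e f (λ { refl → v≢w (joins-unique e je jf) }) ce≡cf)

  private
    -- The `k` edges at `u` have distinct colours, and there are only `k` colours, so each one
    -- occurs.
    hit : ∀ c u → ∃ λ i → colour (proj₁ (ray u i)) ≡ c
    hit c u = injective⇒surjective
      (λ {i} {j} eq → nbr-inj u (same-page⇒≡ _ _ eq (proj₂ (ray u i)) (proj₂ (ray u j)))) c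

  mate : Fin k → Fin n → Fin n
  mate c u = nbr u (proj₁ (hit c u))

  mate-edge : ∀ c u → ∃ λ e → colour e ≡ c × Joins e u (mate c u)
  mate-edge c u with i , eq ← hit c u = proj₁ (ray u i) , eq , proj₂ (ray u i)

  mate-unique : ∀ {c} e {u v} → colour e ≡ c → Joins e u v → mate c u ≡ v
  mate-unique {c} e {u} ce≡c je with f , cf≡c , jf ← mate-edge c u =
    same-page⇒≡ f e (trans cf≡c (sym ce≡c)) jf je

  module _ (c : Fin k) where

    private
      pos = order ⟨$⟩ʳ_
      at  = order ⟨$⟩ˡ_

    -- The matching of page `c`, carried over from vertices to positions.
    π : Fin n → Fin n
    π p = pos (mate c (at p))

    at-π : ∀ p → at (π p) ≡ mate c (at p)
    at-π p = inverseˡ order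

    π-involutive : ∀ p → π (π p) ≡ p
    π-involutive p with e , ce≡c , je ← mate-edge c (at p) =
      trans (cong pos (trans (cong (mate c) (at-π p)) (mate-unique e ce≡c (joins-sym e je))))
        (inverseʳ order)

    π-irrefl : ∀ p → π p ≢ p
    π-irrefl p πp≡p with e , ce≡c , je ← mate-edge c (at p) =
      joins-irrefl e (subst (Joins e (at p)) (trans (sym (at-π p)) (cong at πp≡p)) je)

    π-noncrossing : ∀ {p q} → q ≢ p → q ≢ π p → ¬ Cross (toℕ p) (toℕ (π p)) (toℕ q) (toℕ (π q))
    π-noncrossing {p} {q} q≢p q≢πp x
      with e , ce≡c , je ← mate-edge c (at p) | f , cf≡c , jf ← mate-edge c (at q) =
      non-crossing e f e≢f (trans ce≡c (sym cf≡c))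
        (cross⇒crosses order e f je jf
          (subst₂ (λ a b → Cross (toℕ a) (toℕ (π p)) (toℕ b) (toℕ (π q)))
            (sym (inverseʳ order)) (sym (inverseʳ order)) x))
      where
      at-injective : ∀ {a b} → at a ≡ at b → a ≡ b
      at-injective eq = trans (sym (inverseʳ order)) (trans (cong pos eq) (inverseʳ order))
      e≢f : e ≢ f
      e≢f refl with joins-ends e je jf
      ... | inj₁ q≡p  = q≢p (at-injective q≡p)
      ... | inj₂ q≡πp = q≢πp (at-injective (trans q≡πp (sym (at-π p))))

    -- If `π q` lay outside the arc from `p` to `π p`, the two chords would cross; if it were an end
    -- of that arc, involutivity would make `q` the other end.
    π-nested : ∀ {p q} → p Fin.< q → q Fin.< π p → p Fin.< π q × π q Fin.< π p
    π-nested {p} {q} p<q q<πp with Fin.<-cmp (π q) p | Fin.<-cmp (π q) (π p)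
    ... | tri< πq<p _ _ | _ = contradiction
            (inj₁ (inj₁ (p<q , q<πp) , inj₂ (inj₁ (πq<p , ℕ.<-trans p<q q<πp))))
            (π-noncrossing (Fin.<⇒≢ p<q ∘ sym) (Fin.<⇒≢ q<πp))
    ... | tri≈ _ πq≡p _ | _ =
            contradiction (trans (sym (π-involutive q)) (cong π πq≡p)) (Fin.<⇒≢ q<πp)
    ... | tri> _ _ p<πq | tri< πq<πp _ _ = p<πq , πq<πp
    ... | tri> _ _ p<πq | tri≈ _ πq≡πp _ = contradiction
            (trans (sym (π-involutive p)) (trans (cong π (sym πq≡πp)) (π-involutive q)))
            (Fin.<⇒≢ p<q)
    ... | tri> _ _ p<πq | tri> _ _ πp<πq = contradiction
            (inj₁ (inj₁ (p<q , q<πp) , inj₂ (inj₂ (ℕ.<-trans p<q q<πp , πp<πq))))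
            (π-noncrossing (Fin.<⇒≢ p<q ∘ sym) (Fin.<⇒≢ q<πp))

  -- On the page of the edge `uv`, the positions of `u` and `v` are the ends of one arc.
  adjacent⇒opposite-parity : ∀ {u v} → Graph.Adj G u v →
    parity (toℕ (order ⟨$⟩ʳ v)) ≡ parity (toℕ (order ⟨$⟩ʳ u)) ⁻¹
  adjacent⇒opposite-parity {u} {v} uv with e , je ← adj⇒joined {G = G} uv =
    trans (cong (parity ∘ toℕ) (sym πu≡v))
      (NonCrossingMatching.arc-parity (π c) (π-involutive c) (π-irrefl c) (π-nested c)
        (order ⟨$⟩ʳ u))
    where
    c = colour e
    πu≡v : π c (order ⟨$⟩ʳ u) ≡ order ⟨$⟩ʳ v
    πu≡v = cong (order ⟨$⟩ʳ_) (trans (cong (mate c) (inverseˡ order)) (mate-unique e refl je))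

  triangle-free : ∀ {u v w} → Graph.Adj G u v → Graph.Adj G v w → ¬ Graph.Adj G w u
  triangle-free {u} {v} {w} uv vw wu = odd _
    (trans (adjacent⇒opposite-parity wu) (cong _⁻¹ (trans (adjacent⇒opposite-parity vw)
      (cong _⁻¹ (adjacent⇒opposite-parity uv)))))
    where
    odd : ∀ p → ¬ p ≡ p ⁻¹ ⁻¹ ⁻¹
    odd 0ℙ ()
    odd 1ℙ ()

-- Rotation modulo n.

-- Both summands are below `n`, so reduction subtracts `n` at most once. Adding `n` on the left
-- avoids truncated subtraction.
⊕-cases : ∀ {n} (u : Fin n) {i} → i < n →
          toℕ (u ⊕ i) ≡ toℕ u + i ⊎ toℕ (u ⊕ i) + n ≡ toℕ u + i
⊕-cases {n@(suc _)} u {i} i<n with toℕ u + i ℕ.<? n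
... | yes u+i<n = inj₁ (trans (Fin.toℕ-fromℕ< _) (m<n⇒m%n≡m u+i<n))
... | no  u+i≮n = inj₂ (begin
  toℕ (u ⊕ i) + n            ≡⟨ cong (_+ n) (Fin.toℕ-fromℕ< _) ⟩
  (toℕ u + i) % n + n        ≡⟨ cong (_+ n) (m≤n⇒[n∸m]%m≡n%m n≤u+i) ⟨
  (toℕ u + i ∸ n) % n + n    ≡⟨ cong (_+ n) (m<n⇒m%n≡m u+i∸n<n) ⟩
  toℕ u + i ∸ n + n          ≡⟨ ℕ.m∸n+n≡m n≤u+i ⟩
  toℕ u + i                  ∎)
  where
  open ≡-Reasoning
  n≤u+i = ℕ.≮⇒≥ u+i≮n
  u+i∸n<n : toℕ u + i ∸ n < n
  u+i∸n<n = subst (toℕ u + i ∸ n <_) (ℕ.m+n∸n≡m n n)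
    (ℕ.∸-monoˡ-< (ℕ.+-mono-< (Fin.toℕ<n u) i<n) n≤u+i)

private
  -- The equations combine to `i + n ≡ j`: a wrapped and an unwrapped sum agree only if `j` is at
  -- least a full turn.
  wrapped : ∀ {u x y i j n} → x ≡ u + i → y + n ≡ u + j → x ≡ y → n ≤ j
  wrapped {u} {i = i} {j} {n} refl q refl = ℕ.≤-trans (ℕ.m≤n+m n i)
    (ℕ.≤-reflexive (ℕ.+-cancelˡ-≡ u (i + n) j (trans (sym (ℕ.+-assoc u i n)) q)))

⊕-cancelˡ : ∀ {n} (u : Fin n) {i j} → i < n → j < n → u ⊕ i ≡ u ⊕ j → i ≡ j
⊕-cancelˡ {n} u {i} {j} i<n j<n eq with ⊕-cases u i<n | ⊕-cases u j<n
... | inj₁ p | inj₁ q = ℕ.+-cancelˡ-≡ (toℕ u) i j (trans (sym p) (trans (cong toℕ eq) q))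
... | inj₂ p | inj₂ q = ℕ.+-cancelˡ-≡ (toℕ u) i j (trans (sym p) (trans (cong ((_+ n) ∘ toℕ) eq) q))
... | inj₁ p | inj₂ q = contradiction j<n (ℕ.≤⇒≯ (wrapped p q (cong toℕ eq)))
... | inj₂ p | inj₁ q = contradiction i<n (ℕ.≤⇒≯ (wrapped q p (sym (cong toℕ eq))))

-- Exactly one of the two additions wraps: without a wrap the result would be at least `n`, and with
-- two wraps `u` would be.
⊕-inverse : ∀ {n} (u : Fin n) {i j} → i < n → j < n → i + j ≡ n → (u ⊕ i) ⊕ j ≡ u
⊕-inverse {n} u {i} {j} i<n j<n i+j≡n =
  Fin.toℕ-injective (unwrap i+j≡n (Fin.toℕ<n u) (Fin.toℕ<n _) (⊕-cases u i<n) (⊕-cases (u ⊕ i) j<n))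
  where
  unwrapped : ∀ v i j {u} → v + (i + j) ≡ u + i → v + j ≡ u
  unwrapped v i j {u} p = ℕ.+-cancelʳ-≡ i (v + j) u
    (trans (trans (ℕ.+-assoc v j i) (cong (v +_) (ℕ.+-comm j i))) p)
  unwrap : ∀ {u v w i j n} → i + j ≡ n → u < n → w < n →
           v ≡ u + i ⊎ v + n ≡ u + i → w ≡ v + j ⊎ w + n ≡ v + j → w ≡ u
  unwrap {u} {i = i} {j} refl u<n w<n (inj₁ refl) (inj₁ refl) =
    contradiction w<n (ℕ.≤⇒≯ (subst (i + j ≤_) (sym (ℕ.+-assoc u i j)) (ℕ.m≤n+m (i + j) u)))
  unwrap {u} {w = w} {i} {j} refl u<n w<n (inj₁ refl) (inj₂ q) =
    ℕ.+-cancelʳ-≡ (i + j) w u (trans q (ℕ.+-assoc u i j))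
  unwrap {u} {v} {i = i} {j} refl u<n w<n (inj₂ p) (inj₁ refl) = unwrapped v i j p
  unwrap {u} {v} {w} {i} {j} refl u<n w<n (inj₂ p) (inj₂ q) =
    contradiction u<n (ℕ.≤⇒≯ (subst (i + j ≤_) (trans q (unwrapped v i j p)) (ℕ.m≤n+m (i + j) w)))

-- Maximum degree of a regular graph.

-- The upper bound must also cover the default value 0 of `max`; the vertex `v` attains `k`.
regular⇒maxDegree : ∀ {n k} (G : Graph n) → Fin n → (∀ v → degree G v ≡ k) → maxDegree G ≡ k
regular⇒maxDegree {n} G v deg = ℕ.≤-antisym
  (max≤v⁺ z≤n (All.map⁺ (All.universal (ℕ.≤-reflexive ∘ deg) (allFin n))))
  (v≤max⁺ 0 (map (degree G) (allFin n))
    (inj₂ (Any.map⁺ (lose (∈-allFin v) (ℕ.≤-reflexive (sym (deg v)))))))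

maxDegree⇒nearlyDispersable : ∀ {n k} (G : Graph n) → maxDegree G ≡ k → ¬ Dispersable G →
                              MatchingBookEmbedding G (suc k) → NearlyDispersable G
maxDegree⇒nearlyDispersable G refl ¬disp E = ¬disp , E

-- Five colour classes, each a matching.

parity-suc-≢ : ∀ n → parity (suc n) ≢ parity n
parity-suc-≢ n eq = p≢p⁻¹ (parity n) (trans (sym eq) (parity-suc n))

-- A gap of two is what keeps an inequality strict under halving.
same-parity-<⇒2+≤ : ∀ {u v} → parity u ≡ parity v → u < v → 2 + u ≤ v
same-parity-<⇒2+≤ {u} eq u<v = ℕ.≤∧≢⇒< u<v λ { refl → parity-suc-≢ u (sym eq) }

data Colour : Set where
  zigzag : Parity → Colour
  rail   : Parity → Colour
  spare  : Colour

toFin : Colour → Fin 5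
toFin (zigzag 0ℙ) = zero
toFin (zigzag 1ℙ) = suc zero
toFin (rail 0ℙ)   = suc (suc zero)
toFin (rail 1ℙ)   = suc (suc (suc zero))
toFin spare       = suc (suc (suc (suc zero)))

fromFin : Fin 5 → Colour
fromFin zero                         = zigzag 0ℙ
fromFin (suc zero)                   = zigzag 1ℙ
fromFin (suc (suc zero))             = rail 0ℙ
fromFin (suc (suc (suc zero)))       = rail 1ℙ
fromFin (suc (suc (suc (suc zero)))) = spare

fromFin-toFin : ∀ c → fromFin (toFin c) ≡ c
fromFin-toFin (zigzag 0ℙ) = refl
fromFin-toFin (zigzag 1ℙ) = refl
fromFin-toFin (rail 0ℙ)   = refl
fromFin-toFin (rail 1ℙ)   = refl
fromFin-toFin spare       = refl

toFin-fromFin : ∀ i → toFin (fromFin i) ≡ i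
toFin-fromFin zero                         = refl
toFin-fromFin (suc zero)                   = refl
toFin-fromFin (suc (suc zero))             = refl
toFin-fromFin (suc (suc (suc zero)))       = refl
toFin-fromFin (suc (suc (suc (suc zero)))) = refl

-- Here n = 5 + m.  The edges {i,i+2} alternate between the two rail pages along the path of
-- even vertices and along the path of odd vertices; the third page `spare` corrects the
-- phase near the far ends so that the three wrap-around edges fit.  When m = 0 the edge
-- {m,m+2} is already covered by `skip 0`.
data Page (m : ℕ) : Colour → ℕ → ℕ → Set where
  step     : ∀ {p} i → parity i ≡ p → Page m (zigzag p) i (1 + i)
  skip     : ∀ {p} i → parity ⌈ i /2⌉ ≡ p → i ≤ pred m → Page m (rail p) i (2 + i)
  skip-m   : m ≢ 0 → Page m spare m (2 + m)
  skip-m+1 : Page m spare (1 + m) (3 + m)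
  skip-m+2 : Page m (rail 1ℙ) (2 + m) (4 + m)
  wrap₁    : Page m spare 0 (4 + m)
  wrap₂    : Page m (rail 1ℙ) 0 (3 + m)
  wrap₂′   : Page m (rail 0ℙ) 1 (4 + m)

Disjoint : (a b c d : ℕ) → Set
Disjoint a b c d = (a ≢ c × a ≢ d) × (b ≢ c × b ≢ d)

disjoint-sym : ∀ {a b c d} → Disjoint a b c d → Disjoint c d a b
disjoint-sym ((ac , ad) , (bc , bd)) = (ac ∘ sym , bc ∘ sym) , (ad ∘ sym , bd ∘ sym)

private
  far : ∀ {m i} k → i ≤ pred m → i ≢ suc k + m
  far {m} k i≤ refl = ℕ.<⇒≱ (ℕ.m≤n+m (suc m) k)
    (subst (_≤ m) (sym (ℕ.+-suc k m)) (ℕ.≤-trans i≤ ℕ.pred[n]≤n))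

  -- As `pred 0` is 0, the bound does not exclude `i = m = 0`; there the parity does.
  skip-≢-m : ∀ {m i} → parity ⌈ i /2⌉ ≡ 1ℙ → i ≤ pred m → i ≢ m
  skip-≢-m {ℕ.zero} () i≤ refl
  skip-≢-m {suc m}  _  i≤ refl = ℕ.<-irrefl refl i≤

  flipped : ∀ {a b c d} → (a ≡ c × b ≡ d) ⊎ Disjoint a b c d → (c ≡ a × d ≡ b) ⊎ Disjoint c d a b
  flipped = Sum.map (λ (p , q) → sym p , sym q) disjoint-sym

-- If distinct `step`s or `skip`s met, the upper end of one would be the lower end of the other,
-- which flips the parity of `i` or of `⌈ i /2⌉`. Other pairs are separated by their ranges, except
-- near 0, 1 and `m`, where parity or `m ≢ 0` decides.
page-matching : ∀ {m c a b a′ b′} → Page m c a b → Page m c a′ b′ →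
                (a ≡ a′ × b ≡ b′) ⊎ Disjoint a b a′ b′
page-matching (step i p) (step j q) with i ℕ.≟ j
... | yes refl = inj₁ (refl , refl)
... | no  i≢j  = inj₂
  ( (i≢j , λ { refl → parity-suc-≢ j (trans p (sym q)) })
  , ((λ { refl → parity-suc-≢ i (trans q (sym p)) }) , i≢j ∘ ℕ.suc-injective))
page-matching (skip i p _) (skip j q _) with i ℕ.≟ j
... | yes refl = inj₁ (refl , refl)
... | no  i≢j  = inj₂
  ( (i≢j , λ { refl → parity-suc-≢ ⌈ j /2⌉ (trans p (sym q)) })
  , ((λ { refl → parity-suc-≢ ⌈ i /2⌉ (trans q (sym p)) })
    , i≢j ∘ ℕ.suc-injective ∘ ℕ.suc-injective))
page-matching (skip i p i≤) skip-m+2 = inj₂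
  ( (far 1 i≤ , far 3 i≤)
  , (skip-≢-m p i≤ ∘ ℕ.suc-injective ∘ ℕ.suc-injective)
  , (far 1 i≤ ∘ ℕ.suc-injective ∘ ℕ.suc-injective))
-- Vertex 0 can meet only `skip 0`, of `rail 0ℙ`, and vertex 1 only `skip 1`, of `rail 1ℙ`; each
-- wrap-around edge takes the opposite rail.
page-matching (skip i p i≤) wrap₂ = inj₂
  ( ((λ { refl → contradiction p λ () }) , far 2 i≤)
  , (λ ()) , (far 0 i≤ ∘ ℕ.suc-injective ∘ ℕ.suc-injective))
page-matching (skip i p i≤) wrap₂′ = inj₂
  ( ((λ { refl → contradiction p λ () }) , far 3 i≤)
  , (λ ()) , (far 1 i≤ ∘ ℕ.suc-injective ∘ ℕ.suc-injective))
page-matching skip-m+2 wrap₂ = inj₂ (((λ ()) , (λ ())) , ((λ ()) , (λ ())))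
page-matching (skip-m _)   skip-m+1     = inj₂ (((λ ()) , (λ ())) , ((λ ()) , (λ ())))
page-matching (skip-m m≢0) wrap₁        = inj₂ ((m≢0 , (λ ())) , ((λ ()) , (λ ())))
page-matching skip-m+1     wrap₁        = inj₂ (((λ ()) , (λ ())) , ((λ ()) , (λ ())))
page-matching (skip-m _)   (skip-m _)   = inj₁ (refl , refl)
page-matching skip-m+1     skip-m+1     = inj₁ (refl , refl)
page-matching skip-m+2     skip-m+2     = inj₁ (refl , refl)
page-matching wrap₁        wrap₁        = inj₁ (refl , refl)
page-matching wrap₂        wrap₂        = inj₁ (refl , refl)
page-matching wrap₂′       wrap₂′       = inj₁ (refl , refl)
page-matching e@skip-m+2   f@(skip _ _ _) = flipped (page-matching f e)
page-matching e@wrap₂      f@(skip _ _ _) = flipped (page-matching f e)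
page-matching e@wrap₂′     f@(skip _ _ _) = flipped (page-matching f e)
page-matching e@wrap₂      f@skip-m+2     = flipped (page-matching f e)
page-matching e@skip-m+1   f@(skip-m _)   = flipped (page-matching f e)
page-matching e@wrap₁      f@(skip-m _)   = flipped (page-matching f e)
page-matching e@wrap₁      f@skip-m+1     = flipped (page-matching f e)

-- The circular order: even vertices rising, odd vertices falling.

module ZigzagOrder (N : ℕ) where

  -- `N` is the last vertex; `2j` goes to `j` and `2j + 1` to `N - j`. The parity is a separate
  -- argument so that a known parity can be substituted by congruence.
  place : Parity → ℕ → ℕ
  place 0ℙ v = ⌊ v /2⌋
  place 1ℙ v = suc N ∸ ⌈ v /2⌉

  position : ℕ → ℕ
  position v = place (parity v) v

  even-position : ∀ {v} → parity v ≡ 0ℙ → position v ≡ ⌊ v /2⌋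
  even-position {v} eq = cong (λ p → place p v) eq

  odd-position : ∀ {v} → parity v ≡ 1ℙ → position v ≡ suc N ∸ ⌈ v /2⌉
  odd-position {v} eq = cong (λ p → place p v) eq

  position-even-< : ∀ {u v} → parity u ≡ 0ℙ → parity v ≡ 0ℙ → u < v → position u < position v
  position-even-< {u} {v} pu pv u<v = subst₂ _<_
    (sym (even-position {u} pu)) (sym (even-position {v} pv))
    (ℕ.⌊n/2⌋-mono (same-parity-<⇒2+≤ (trans pu (sym pv)) u<v))

  position-odd-> : ∀ {u v} → parity u ≡ 1ℙ → parity v ≡ 1ℙ → v ≤ N → u < v → position v < position u
  position-odd-> {u} {v} pu pv v≤N u<v = subst₂ _<_
    (sym (odd-position {v} pv)) (sym (odd-position {u} pu))
    (ℕ.∸-monoʳ-< (ℕ.⌈n/2⌉-mono (same-parity-<⇒2+≤ (trans pu (sym pv)) u<v))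
      (ℕ.≤-trans (ℕ.⌈n/2⌉≤n v) (ℕ.m≤n⇒m≤1+n v≤N)))

  -- The rising and the falling run do not meet, because the two halves of `N` add up to `N`.
  position-even<odd : ∀ {u v} → parity u ≡ 0ℙ → parity v ≡ 1ℙ → u ≤ N → v ≤ N →
                      position u < position v
  position-even<odd {u} {v} pu pv u≤N v≤N = subst₂ _<_
    (sym (even-position {u} pu)) (sym (odd-position {v} pv))
    (ℕ.m+n≤o⇒m≤o∸n (suc ⌊ u /2⌋) (s≤s (begin
      ⌊ u /2⌋ + ⌈ v /2⌉    ≤⟨ ℕ.+-mono-≤ (ℕ.⌊n/2⌋-mono u≤N) (ℕ.⌈n/2⌉-mono v≤N) ⟩
      ⌊ N /2⌋ + ⌈ N /2⌉    ≡⟨ ℕ.⌊n/2⌋+⌈n/2⌉≡n N ⟩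
      N                    ∎)))
    where open ℕ.≤-Reasoning

  position-bounded : ∀ {v} → v ≤ N → position v < suc N
  position-bounded {v} v≤N with parity v in pv
  ... | 0ℙ = s≤s (ℕ.≤-trans (ℕ.⌊n/2⌋≤n v) v≤N)
  -- An odd vertex is a successor, so at least 1 is subtracted from `suc N`.
  position-bounded {suc v} v≤N | 1ℙ = s≤s (ℕ.m∸n≤m N ⌊ v /2⌋)

  position-< : ∀ {u v} → v ≤ N → u < v → position u ≢ position v
  position-< {u} {v} v≤N u<v = go (parity u) (parity v) refl refl
    where
    u≤N = ℕ.≤-trans (ℕ.<⇒≤ u<v) v≤N
    go : ∀ p q → parity u ≡ p → parity v ≡ q → position u ≢ position v
    go 0ℙ 0ℙ pu pv = ℕ.<⇒≢ (position-even-< pu pv u<v)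
    go 0ℙ 1ℙ pu pv = ℕ.<⇒≢ (position-even<odd pu pv u≤N v≤N)
    go 1ℙ 0ℙ pu pv = ℕ.<⇒≢ (position-even<odd pv pu v≤N u≤N) ∘ sym
    go 1ℙ 1ℙ pu pv = ℕ.<⇒≢ (position-odd-> pu pv v≤N u<v) ∘ sym

  position-injective : ∀ {u v} → u ≤ N → v ≤ N → position u ≡ position v → u ≡ v
  position-injective {u} {v} u≤N v≤N eq with ℕ.<-cmp u v
  ... | tri< u<v _ _ = contradiction eq (position-< v≤N u<v)
  ... | tri≈ _ u≡v _ = u≡v
  ... | tri> _ _ v<u = contradiction (sym eq) (position-< u≤N v<u)

  private
    ≤N : (v : Fin (suc N)) → toℕ v ≤ N
    ≤N v = ℕ.s≤s⁻¹ (Fin.toℕ<n v)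

    seat : Fin (suc N) → Fin (suc N)
    seat v = fromℕ< (position-bounded (≤N v))

    toℕ-seat : ∀ v → toℕ (seat v) ≡ position (toℕ v)
    toℕ-seat v = Fin.toℕ-fromℕ< _

    seat-injective : Injective _≡_ _≡_ seat
    seat-injective {u} {v} eq = Fin.toℕ-injective (position-injective (≤N u) (≤N v)
      (trans (sym (toℕ-seat u)) (trans (cong toℕ eq) (toℕ-seat v))))

    seat⁻¹ : ∀ p → ∃ λ v → seat v ≡ p
    seat⁻¹ = injective⇒surjective seat-injective

  -- The inverse has no formula here; it comes from the pigeonhole principle.
  order : CyclicOrder (suc N)
  order = permutation seat (proj₁ ∘ seat⁻¹) (proj₂ ∘ seat⁻¹)
    (λ v → seat-injective (proj₂ (seat⁻¹ (seat v))))

  toℕ-order : ∀ v → toℕ (order ⟨$⟩ʳ v) ≡ position (toℕ v)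
  toℕ-order = toℕ-seat

  -- Adding 2 keeps the parity and raises the half by one: one seat up for even `i`, one seat down
  -- for odd `i`.
  skip-consecutive : ∀ i → 2 + i ≤ N →
                     position (2 + i) ≡ suc (position i) ⊎ position i ≡ suc (position (2 + i))
  skip-consecutive i 2+i≤N with parity i
  ... | 0ℙ = inj₁ refl
  ... | 1ℙ = inj₂ (ℕ.+-∸-assoc 1
    (ℕ.≤-trans (ℕ.⌈n/2⌉≤n i) (ℕ.≤-trans (ℕ.n≤1+n i) (ℕ.<⇒≤ 2+i≤N))))

  private
    -- Even ends move up and odd ends down as `i` grows, so the later chord lies inside the earlier
    -- one. For odd `i` the lower positions belong to `suc i` and `suc j`, hence the swaps.
    steps-nested : ∀ p {i j} → parity i ≡ p → parity j ≡ p → suc j ≤ N → i < j →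
                   ¬ Cross (position i) (position (suc i)) (position j) (position (suc j))
    steps-nested 0ℙ {i} {j} pi pj 1+j≤N i<j = nested⇒¬cross
      (position-even-< pi pj i<j)
      (position-even<odd pj psj (ℕ.<⇒≤ 1+j≤N) 1+j≤N)
      (position-odd-> psi psj 1+j≤N (s≤s i<j))
      where
      psi = trans (parity-suc i) (cong _⁻¹ pi)
      psj = trans (parity-suc j) (cong _⁻¹ pj)
    steps-nested 1ℙ {i} {j} pi pj 1+j≤N i<j = nested⇒¬cross
      (position-even-< psi psj (s≤s i<j))
      (position-even<odd psj pj 1+j≤N (ℕ.<⇒≤ 1+j≤N))
      (position-odd-> pi pj (ℕ.<⇒≤ 1+j≤N) i<j)
      ∘ cross-swapʳ ∘ cross-swapˡ
      where
      psi = trans (parity-suc i) (cong _⁻¹ pi)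
      psj = trans (parity-suc j) (cong _⁻¹ pj)

  steps-noncrossing : ∀ {i j} → parity i ≡ parity j → i ≢ j → suc i ≤ N → suc j ≤ N →
                      ¬ Cross (position i) (position (suc i)) (position j) (position (suc j))
  steps-noncrossing {i} {j} pij i≢j 1+i≤N 1+j≤N with ℕ.<-cmp i j
  ... | tri< i<j _ _ = steps-nested _ pij refl 1+j≤N i<j
  ... | tri≈ _ i≡j _ = contradiction i≡j i≢j
  ... | tri> _ _ j<i = steps-nested _ refl pij 1+i≤N j<i ∘ cross-sym

-- The circulant of order 5 + m: regularity and the lower bound.

-- Only the adjacency of G is visible: reducing the degrees of a concrete circulant of
-- symbolic order is infeasible.
module SquareOfCycle
  (m : ℕ) (G : Graph (5 + m))
  (adj⁺ : ∀ {u v} → Any (λ i → v ≡ u ⊕ i ⊎ u ≡ v ⊕ i) (1 ∷ 2 ∷ []) → Graph.Adj G u v)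
  (adj⁻ : ∀ {u v} → Graph.Adj G u v → Any (λ i → v ≡ u ⊕ i ⊎ u ≡ v ⊕ i) (1 ∷ 2 ∷ []))
  where

  -- The residues 1, 2, -1, -2 modulo `5 + m`, distinct because the order is at least 5.
  offset : Fin 4 → ℕ
  offset zero                   = 1
  offset (suc zero)             = 2
  offset (suc (suc zero))       = 4 + m
  offset (suc (suc (suc zero))) = 3 + m

  offset<n : ∀ i → offset i < 5 + m
  offset<n zero                   = s≤s (s≤s z≤n)
  offset<n (suc zero)             = s≤s (s≤s (s≤s z≤n))
  offset<n (suc (suc zero))       = ℕ.≤-refl
  offset<n (suc (suc (suc zero))) = ℕ.n≤1+n _

  offset-injective : Injective _≡_ _≡_ offset
  offset-injective {zero} {zero} _  = refl
  offset-injective {zero} {suc zero} ()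
  offset-injective {zero} {suc (suc zero)} ()
  offset-injective {zero} {suc (suc (suc zero))} ()
  offset-injective {suc zero} {zero} ()
  offset-injective {suc zero} {suc zero} _  = refl
  offset-injective {suc zero} {suc (suc zero)} ()
  offset-injective {suc zero} {suc (suc (suc zero))} ()
  offset-injective {suc (suc zero)} {zero} ()
  offset-injective {suc (suc zero)} {suc zero} ()
  offset-injective {suc (suc zero)} {suc (suc zero)} _  = refl
  offset-injective {suc (suc zero)} {suc (suc (suc zero))} ()
  offset-injective {suc (suc (suc zero))} {zero} ()
  offset-injective {suc (suc (suc zero))} {suc zero} ()
  offset-injective {suc (suc (suc zero))} {suc (suc zero)} ()
  offset-injective {suc (suc (suc zero))} {suc (suc (suc zero))} _  = refl

  nbr : Fin (5 + m) → Fin 4 → Fin (5 + m)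
  nbr u i = u ⊕ offset i

  nbr-injective : ∀ u → Injective _≡_ _≡_ (nbr u)
  nbr-injective u {i} {j} eq = offset-injective (⊕-cancelˡ u (offset<n i) (offset<n j) eq)

  nbr-adjacent : ∀ u i → Graph.Adj G u (nbr u i)
  nbr-adjacent u zero                   = adj⁺ (here (inj₁ refl))
  nbr-adjacent u (suc zero)             = adj⁺ (there (here (inj₁ refl)))
  nbr-adjacent u (suc (suc zero))       = adj⁺ (here (inj₂ (sym
    (⊕-inverse u (offset<n (suc (suc zero))) (offset<n zero) (ℕ.+-comm (4 + m) 1)))))
  nbr-adjacent u (suc (suc (suc zero))) = adj⁺ (there (here (inj₂ (sym
    (⊕-inverse u (offset<n (suc (suc (suc zero)))) (offset<n (suc zero)) (ℕ.+-comm (3 + m) 2))))))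

  adjacent⇒nbr : ∀ {u v} → Graph.Adj G u v → ∃ λ i → nbr u i ≡ v
  adjacent⇒nbr {v = v} uv with adj⁻ uv
  ... | here (inj₁ refl)         = zero , refl
  ... | here (inj₂ refl)         = suc (suc zero) ,
    ⊕-inverse v (offset<n zero) (offset<n (suc (suc zero))) refl
  ... | there (here (inj₁ refl)) = suc zero , refl
  ... | there (here (inj₂ refl)) = suc (suc (suc zero)) ,
    ⊕-inverse v (offset<n (suc zero)) (offset<n (suc (suc (suc zero)))) refl

  degree≡4 : ∀ v → degree G v ≡ 4
  degree≡4 v = degree-≡ G v (nbr v) (nbr-injective v) (nbr-adjacent v) adjacent⇒nbr

  maxDegree≡4 : maxDegree G ≡ 4
  maxDegree≡4 = regular⇒maxDegree G zero degree≡4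

  not-dispersable : ¬ Dispersable G
  not-dispersable E = RegularEmbedding.triangle-free nbr nbr-injective nbr-adjacent
    (subst (MatchingBookEmbedding G) maxDegree≡4 E)
    -- The triangle on 0, 1, 2 is present for every `m`.
    {zero} {suc zero} {suc (suc zero)}
    (adj⁺ (here (inj₁ refl))) (adj⁺ (here (inj₁ refl))) (adj⁺ (there (here (inj₂ refl))))

  -- Every edge has a page, and five pages suffice.

  open ZigzagOrder (4 + m)

  skip-noncrossing : ∀ a {c d} → 2 + a ≤ 4 + m → ¬ Cross (position a) (position (2 + a)) c d
  skip-noncrossing a 2+a≤ = consecutive⇒¬cross (skip-consecutive a 2+a≤)

  -- Each rail or spare page has a single wrap-around edge, so of two distinct edges there one joins
  -- consecutive positions.
  page-noncrossing : ∀ {c a b a′ b′} → Page m c a b → Page m c a′ b′ → b ≤ 4 + m → b′ ≤ 4 + m →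
                     a ≢ a′ → ¬ Cross (position a) (position b) (position a′) (position b′)
  page-noncrossing (step i p)   (step j q)   b≤ b′≤ a≢ =
    steps-noncrossing (trans p (sym q)) a≢ b≤ b′≤
  page-noncrossing (skip i _ _) _            b≤ b′≤ a≢ = skip-noncrossing i b≤
  page-noncrossing (skip-m _)   _            b≤ b′≤ a≢ = skip-noncrossing m b≤
  page-noncrossing skip-m+1     _            b≤ b′≤ a≢ = skip-noncrossing (1 + m) b≤
  page-noncrossing skip-m+2     _            b≤ b′≤ a≢ = skip-noncrossing (2 + m) b≤
  page-noncrossing wrap₁        (skip-m _)   b≤ b′≤ a≢ = skip-noncrossing m b′≤ ∘ cross-sym
  page-noncrossing wrap₁        skip-m+1     b≤ b′≤ a≢ = skip-noncrossing (1 + m) b′≤ ∘ cross-sym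
  page-noncrossing wrap₁        wrap₁        b≤ b′≤ a≢ = contradiction refl a≢
  page-noncrossing wrap₂        (skip j _ _) b≤ b′≤ a≢ = skip-noncrossing j b′≤ ∘ cross-sym
  page-noncrossing wrap₂        skip-m+2     b≤ b′≤ a≢ = skip-noncrossing (2 + m) b′≤ ∘ cross-sym
  page-noncrossing wrap₂        wrap₂        b≤ b′≤ a≢ = contradiction refl a≢
  page-noncrossing wrap₂′       (skip j _ _) b≤ b′≤ a≢ = skip-noncrossing j b′≤ ∘ cross-sym
  page-noncrossing wrap₂′       wrap₂′       b≤ b′≤ a≢ = contradiction refl a≢

  Paged : ℕ → ℕ → Set
  Paged a b = ∃ λ c → Page m c a b

  skip-paged : ∀ {a} → 2 + a < 5 + m → Paged a (2 + a)
  skip-paged {a} (s≤s (s≤s a<3+m)) with a ℕ.<? m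
  ... | yes a<m = _ , skip a refl (ℕ.<⇒≤pred a<m)
  ... | no  a≮m with ℕ.m≤n⇒m<n∨m≡n (ℕ.≮⇒≥ a≮m)
  ...   | inj₂ refl with m ℕ.≟ 0
  ...     | yes refl = _ , skip 0 refl z≤n
  ...     | no  m≢0  = _ , skip-m m≢0
  skip-paged {a} (s≤s (s≤s a<3+m)) | no _ | inj₁ m<a with ℕ.m≤n⇒m<n∨m≡n m<a
  ...     | inj₂ refl = _ , skip-m+1
  ...     | inj₁ 1+m<a with ℕ.≤-antisym 1+m<a (ℕ.s≤s⁻¹ a<3+m)
  ...       | refl = _ , skip-m+2

  -- Here `b + 1` wraps round to `a`; as `b` is at most `4 + m`, only `a = 0` remains.
  step-wrap-paged : ∀ {a b} → b < 5 + m → a + (5 + m) ≡ b + 1 → Paged a b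
  step-wrap-paged {ℕ.zero} {b} b< eq with ℕ.suc-injective (trans eq (ℕ.+-comm b 1))
  ... | refl = _ , wrap₁
  step-wrap-paged {suc a} {b} b< eq with ℕ.suc-injective (trans eq (ℕ.+-comm b 1))
  ... | refl = contradiction b< (ℕ.≤⇒≯ (ℕ.m≤n+m (5 + m) a))

  skip-wrap-paged : ∀ {a b} → b < 5 + m → a + (5 + m) ≡ b + 2 → Paged a b
  skip-wrap-paged {a} {b} b< eq with trans eq (ℕ.+-comm b 2)
  skip-wrap-paged {ℕ.zero}      b< eq | refl = _ , wrap₂
  skip-wrap-paged {suc ℕ.zero}  b< eq | refl = _ , wrap₂′
  skip-wrap-paged {suc (suc a)} b< eq | refl = contradiction b< (ℕ.≤⇒≯ (ℕ.m≤n+m (5 + m) a))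

  private
    -- A wrap would give `v + n = u + i` with `n = 5 + m`, impossible since `u < v` and `i < n`.
    forward : ∀ {u v : Fin (5 + m)} {i} → u Fin.< v → i < 5 + m → v ≡ u ⊕ i → toℕ v ≡ i + toℕ u
    forward {u} {i = i} u<v i<n refl with ⊕-cases u i<n
    ... | inj₁ eq = trans eq (ℕ.+-comm (toℕ u) i)
    ... | inj₂ eq = contradiction (ℕ.+-mono-< u<v i<n) (ℕ.<-irrefl (sym eq))

    backward : ∀ {u v : Fin (5 + m)} {i} → u Fin.< v → i < 5 + m → u ≡ v ⊕ i →
               toℕ u + (5 + m) ≡ toℕ v + i
    backward {v = v} {i} u<v i<n refl with ⊕-cases v i<n
    ... | inj₁ eq = contradiction u<v (ℕ.≤⇒≯ (subst (toℕ v ≤_) (sym eq) (ℕ.m≤m+n (toℕ v) i)))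
    ... | inj₂ eq = eq

  adjacent⇒paged : ∀ {u v} → u Fin.< v → Graph.Adj G u v → Paged (toℕ u) (toℕ v)
  adjacent⇒paged {u} {v} u<v uv with adj⁻ uv
  ... | here (inj₁ e) =
    subst (Paged _) (sym (forward u<v (offset<n zero) e)) (_ , step (toℕ u) refl)
  ... | here (inj₂ e) =
    step-wrap-paged (Fin.toℕ<n v) (backward u<v (offset<n zero) e)
  ... | there (here (inj₁ e)) =
    subst (Paged _) (sym eq) (skip-paged (subst (_< 5 + m) eq (Fin.toℕ<n v)))
    where eq = forward u<v (offset<n (suc zero)) e
  ... | there (here (inj₂ e)) =
    skip-wrap-paged (Fin.toℕ<n v) (backward u<v (offset<n (suc zero)) e)

  edge-paged : (e : Edge G) → Paged (toℕ (src e)) (toℕ (tgt e))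
  edge-paged (edge u v u<v uv) =
    -- The proofs stored in an edge are irrelevant; decidability recovers usable ones.
    adjacent⇒paged (recompute (u Fin.<? v) u<v) (recompute (Graph.adj? G u v) uv)

  colour : Edge G → Colour
  colour e = proj₁ (edge-paged e)

  paged : ∀ e → Page m (colour e) (toℕ (src e)) (toℕ (tgt e))
  paged e = proj₂ (edge-paged e)

  edge-≡ : ∀ {e f : Edge G} → src e ≡ src f → tgt e ≡ tgt f → e ≡ f
  edge-≡ refl refl = refl

  same-page : ∀ {e f} → colour e ≡ colour f → Page m (colour e) (toℕ (src f)) (toℕ (tgt f))
  same-page {f = f} eq = subst (λ c → Page m c _ _) (sym eq) (paged f)

  colour-matching : ∀ e f → e ≢ f → colour e ≡ colour f → ¬ ShareEndpoint e f
  colour-matching e f e≢f ce≡cf share with page-matching (paged e) (same-page {e} {f} ce≡cf) | share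
  ... | inj₁ (p , q) | _ = e≢f (edge-≡ (Fin.toℕ-injective p) (Fin.toℕ-injective q))
  ... | inj₂ ((ss , st) , (ts , tt)) | inj₁ (inj₁ eq) = ss (cong toℕ eq)
  ... | inj₂ ((ss , st) , (ts , tt)) | inj₁ (inj₂ eq) = st (cong toℕ eq)
  ... | inj₂ ((ss , st) , (ts , tt)) | inj₂ (inj₁ eq) = ts (cong toℕ eq)
  ... | inj₂ ((ss , st) , (ts , tt)) | inj₂ (inj₂ eq) = tt (cong toℕ eq)

  colour-noncrossing : ∀ e f → e ≢ f → colour e ≡ colour f → ¬ Crosses order e f
  colour-noncrossing e f e≢f ce≡cf x = page-noncrossing (paged e) (same-page {e} {f} ce≡cf)
    (ℕ.s≤s⁻¹ (Fin.toℕ<n (tgt e))) (ℕ.s≤s⁻¹ (Fin.toℕ<n (tgt f)))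
    -- Equal lower ends would already violate the matching property.
    (λ eq → colour-matching e f e≢f ce≡cf (inj₁ (inj₁ (Fin.toℕ-injective eq))))
    (cross-resp-≡ (toℕ-order (src e)) (toℕ-order (tgt e)) (toℕ-order (src f)) (toℕ-order (tgt f)) x)

  edge-at : ∀ {a i} → 1 ≤ i → i < 5 + m →
            (∀ {u v : Fin (5 + m)} → v ≡ u ⊕ i → Graph.Adj G u v) → i + a < 5 + m →
            ∃ λ (e : Edge G) → toℕ (src e) ≡ a × toℕ (tgt e) ≡ i + a
  edge-at {a} {i} 1≤i i<n adj i+a<n =
    edge u (u ⊕ i) (subst₂ _<_ (sym u≡a) (sym v≡i+a) (ℕ.m<n+m a 1≤i)) (adj refl) , u≡a , v≡i+a
    where
    a<n = ℕ.≤-<-trans (ℕ.m≤n+m a i) i+a<n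
    u = fromℕ< a<n
    u≡a : toℕ u ≡ a
    u≡a = Fin.toℕ-fromℕ< a<n
    u+i≡i+a : toℕ u + i ≡ i + a
    u+i≡i+a = trans (cong (_+ i) u≡a) (ℕ.+-comm a i)
    v≡i+a : toℕ (u ⊕ i) ≡ i + a
    v≡i+a with ⊕-cases u i<n
    ... | inj₁ eq = trans eq u+i≡i+a
    ... | inj₂ eq = contradiction i+a<n
      (ℕ.≤⇒≯ (ℕ.≤-trans (ℕ.m≤n+m (5 + m) _) (ℕ.≤-reflexive (trans eq u+i≡i+a))))

  step-edge : ∀ a → 1 + a < 5 + m → ∃ λ (e : Edge G) → toℕ (src e) ≡ a × toℕ (tgt e) ≡ 1 + a
  step-edge a = edge-at (s≤s z≤n) (offset<n zero) (adj⁺ ∘ here ∘ inj₁)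

  skip-edge : ∀ a → 2 + a < 5 + m → ∃ λ (e : Edge G) → toℕ (src e) ≡ a × toℕ (tgt e) ≡ 2 + a
  skip-edge a = edge-at (s≤s z≤n) (offset<n (suc zero)) (adj⁺ ∘ there ∘ here ∘ inj₁)

  -- The colour is not computed but identified, by checking that only one page can hold these ends.
  colour-by-ends : ∀ {c a b} → (∃ λ (e : Edge G) → toℕ (src e) ≡ a × toℕ (tgt e) ≡ b) →
                   (∀ {c′} → Page m c′ a b → c′ ≡ c) → ∃ λ e → colour e ≡ c
  colour-by-ends (e , refl , refl) unique = e , unique (paged e)

  -- The chosen edges keep their page for every `m`. For `rail 1ℙ` this needs the far end, as
  -- `skip 1` exists only from `m = 2` on.
  colour-surjective : ∀ c → ∃ λ e → colour e ≡ c
  colour-surjective (zigzag 0ℙ) = colour-by-ends (step-edge 0 (s≤s (s≤s z≤n)))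
    λ { (step 0 refl) → refl }
  colour-surjective (zigzag 1ℙ) = colour-by-ends (step-edge 1 (s≤s (s≤s (s≤s z≤n))))
    λ { (step 1 refl) → refl }
  colour-surjective (rail 0ℙ)   = colour-by-ends (skip-edge 0 (s≤s (s≤s (s≤s z≤n))))
    λ { (skip 0 refl _) → refl ; (skip-m m≢0) → contradiction refl m≢0 }
  colour-surjective (rail 1ℙ)   = colour-by-ends (skip-edge (2 + m) ℕ.≤-refl)
    λ { (skip _ _ i≤) → contradiction refl (far 1 i≤) ; skip-m+2 → refl }
  colour-surjective spare       = colour-by-ends (skip-edge (1 + m) (ℕ.n≤1+n _))
    λ { (skip _ _ i≤) → contradiction refl (far 0 i≤) ; skip-m+1 → refl }

  five-pages : MatchingBookEmbedding G 5
  five-pages = record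
    { order        = order
    ; colour       = toFin ∘ colour
    ; surjective   = λ i → let e , eq = colour-surjective (fromFin i) in
                     e , λ { refl → trans (cong toFin eq) (toFin-fromFin i) }
    ; matching     = λ e f e≢f → colour-matching e f e≢f ∘ toFin-injective
    ; non-crossing = λ e f e≢f → colour-noncrossing e f e≢f ∘ toFin-injective
    }
    where
    toFin-injective : ∀ {c d} → toFin c ≡ toFin d → c ≡ d
    toFin-injective {c} {d} eq = trans (sym (fromFin-toFin c))
      (trans (cong fromFin eq) (fromFin-toFin d))

  nearly-dispersable : NearlyDispersable G
  nearly-dispersable = maxDegree⇒nearlyDispersable G maxDegree≡4 not-dispersable five-pages

theorem3 : (n : ℕ) (5≤n : 5 ≤ n) →
    NearlyDispersable (circulant n (1 ∷ 2 ∷ []) (isConnectionSet-1,2 5≤n))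
theorem3 n 5≤n = at-offset 5≤n (ℕ.m≤n⇒∃[o]m+o≡n 5≤n)
  where
  -- Generalising over `n` and `5≤n` lets the equation `5 + m ≡ n` be eliminated although the graph
  -- depends on `5≤n`.
  at-offset : ∀ {n} (5≤n : 5 ≤ n) → (∃ λ m → 5 + m ≡ n) →
              NearlyDispersable (circulant n (1 ∷ 2 ∷ []) (isConnectionSet-1,2 5≤n))
  at-offset 5≤n (m , refl) = SquareOfCycle.nearly-dispersable m
    (circulant (5 + m) (1 ∷ 2 ∷ []) (isConnectionSet-1,2 5≤n)) (λ a → a) (λ a → a)
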